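{- Let $\langle O,\sqsubseteq,\triangleleft\rangle$ be a directed observation structure on a set $\mathbb{B}$. Then every safety property $P\subseteq\mathbb{B}$ is monitorable.
   Context: Let $\mathbb{B}$ be a set (of behaviours). A property is a subset $P\subseteq\mathbb{B}$. An observation structure over $\mathbb{B}$ is a preordered set $\langle O,\sqsubseteq\rangle$ (of observations) together with a relation $\triangleleft\subseteq O\times\mathbb{B}$ such that: (i) $o\sqsubseteq o'$ and $o'\triangleleft b$ imply $o\triangleleft b$; (ii) for every $o\in O$ there is $b\in\mathbb{B}$ with $o\triangleleft b$. It is directed if for all $o,o'\in O$ and $b\in\mathbb{B}$ with $o\triangleleft b$ and $o'\triangleleft b$ there is $o''\in O$ with $o''\triangleleft b$, $o\sqsubseteq o''$ and $o'\sqsubseteq o''$. Put $\mathbb{B}(o)=\{b\in\mathbb{B}\mid o\triangleleft b\}$. The abstract monitor of $P$ is the function $\mathcal{M}_P:O\to\{\mathsf{yes},\mathsf{no},\mathsf{?}\}$ with $\mathcal{M}_P(o)=\mathsf{yes}$ if $\mathbb{B}(o)\subseteq P$, $\mathcal{M}_P(o)=\mathsf{no}$ if $\mathbb{B}(o)\cap P=\emptyset$, and $\mathcal{M}_P(o)=\mathsf{?}$ otherwise. $P$ is monitorable if for every $o\in O$ there is $o'\in O$ with $o\sqsubseteq o'$ and $\mathcal{M}_P(o')\neq\mathsf{?}$. $P$ is a safety property if for every $b\in\mathbb{B}\setminus P$ there is $o\in O$ with $o\triangleleft b$ and $\mathcal{M}_P(o)=\mathsf{no}$. -}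

module Defs where

open import Axiom.ExcludedMiddle using (ExcludedMiddle)
open import Data.Product using (∃-syntax; _×_)
open import Level using (Level; _⊔_; suc)
open import Relation.Binary.Core using (Rel; REL)
open import Relation.Binary.PropositionalEquality using (_≡_; _≢_)
open import Relation.Binary.Structures using (IsPreorder)
open import Relation.Nullary.Decidable using (yes; no)
open import Relation.Unary using (Pred; _∉_; _⊆_; _∩_; Empty)

private
  variable
    b o r t p : Level

record ObservationStructure (𝔹 : Set b) (o r t : Level) : Set (b ⊔ suc (o ⊔ r ⊔ t)) where
  infix 4 _⊑_ _◁_
  field
    Obs        : Set o
    _⊑_        : Rel Obs r
    isPreorder : IsPreorder _≡_ _⊑_
    _◁_        : REL Obs 𝔹 t
    ◁-downward : ∀ {x y β} → x ⊑ y → y ◁ β → x ◁ β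
    ◁-inhabited : ∀ x → ∃[ β ] x ◁ β

  Behaviours : Obs → Pred 𝔹 t
  Behaviours x β = x ◁ β

Directed : {𝔹 : Set b} → ObservationStructure 𝔹 o r t → Set (b ⊔ o ⊔ r ⊔ t)
Directed S = ∀ {x y β} → x ◁ β → y ◁ β → ∃[ z ] (z ◁ β × x ⊑ z × y ⊑ z)
  where open ObservationStructure S

data Verdict : Set where
  Yes No Unknown : Verdict

-- The case distinction defining the abstract monitor is not decidable in
-- general, so the monitor is a function only given excluded middle.
module Monitoring {𝔹 : Set b} (em : ExcludedMiddle (b ⊔ t ⊔ p))
                  (S : ObservationStructure 𝔹 o r t) (P : Pred 𝔹 p) where
  open ObservationStructure S

  -- By ◁-inhabited the first two cases exclude each other, so the order in
  -- which they are tested is irrelevant.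
  monitor : Obs → Verdict
  monitor x with em {Behaviours x ⊆ P} | em {Empty (Behaviours x ∩ P)}
  ... | yes _ | _     = Yes
  ... | no _  | yes _ = No
  ... | no _  | no _  = Unknown

  Monitorable : Set (o ⊔ r)
  Monitorable = ∀ x → ∃[ y ] (x ⊑ y × monitor y ≢ Unknown)

  IsSafety : Set (b ⊔ o ⊔ t ⊔ p)
  IsSafety = ∀ β → β ∉ P → ∃[ x ] (x ◁ β × monitor x ≡ No)

{-# OPTIONS --safe #-}

-- If some behaviour β compatible with x violates P, safety yields a y ◁ β with
-- verdict No.  By directedness x and y have a common extension, and it inherits
-- the verdict No from y.  Otherwise every behaviour compatible with x satisfies
-- P and the verdict at x itself is Yes.
module Submission where

open import Defs
open import Axiom.ExcludedMiddle using (ExcludedMiddle)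
open import Level using (Level; _⊔_)
open import Relation.Unary using (Pred)
open import Data.Product using (∃-syntax; _×_; _,_)
open import Level using (Lift; lift; lower)
open import Relation.Binary.PropositionalEquality using (_≡_; _≢_)
open import Relation.Binary.Structures using (IsPreorder)
open import Relation.Nullary.Decidable using (yes; no; map′; decidable-stable)
open import Relation.Unary using (Decidable; _∉_; _⊆_; _∩_; Empty)

module _ {b o r t p : Level} (em : ExcludedMiddle (b ⊔ t ⊔ p)) {𝔹 : Set b}
         (S : ObservationStructure 𝔹 o r t) (P : Pred 𝔹 p) where
  open ObservationStructure S
  open Monitoring em S P

  private
    -- `em` decides only types at level `b ⊔ t ⊔ p`, so `P β` is lifted there from level `p`.
    P? : Decidable P
    P? β = map′ lower lift (em {Lift (b ⊔ t ⊔ p) (P β)})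

  ⊆⇒monitor≢Unknown : ∀ {x} → Behaviours x ⊆ P → monitor x ≢ Unknown
  -- Repeating the two tests of `monitor` lets `eq` reduce; clashing verdicts rule out the omitted
  -- branches.
  ⊆⇒monitor≢Unknown {x} x⊆P eq with em {Behaviours x ⊆ P} | em {Empty (Behaviours x ∩ P)}
  ... | no x⊈P | _ = x⊈P x⊆P

  disjoint⇒monitor≢Unknown : ∀ {x} → Empty (Behaviours x ∩ P) → monitor x ≢ Unknown
  disjoint⇒monitor≢Unknown {x} x∩P=∅ eq with em {Behaviours x ⊆ P} | em {Empty (Behaviours x ∩ P)}
  ... | no _ | no x∩P≠∅ = x∩P≠∅ x∩P=∅

  monitor≡No⇒disjoint : ∀ {x} → monitor x ≡ No → Empty (Behaviours x ∩ P)
  monitor≡No⇒disjoint {x} eq with em {Behaviours x ⊆ P} | em {Empty (Behaviours x ∩ P)}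
  ... | no _ | yes x∩P=∅ = x∩P=∅

  -- Extending an observation can only discard compatible behaviours.
  disjoint-upward : ∀ {x y} → x ⊑ y → Empty (Behaviours x ∩ P) → Empty (Behaviours y ∩ P)
  disjoint-upward x⊑y x∩P=∅ β (y◁β , β∈P) = x∩P=∅ β (◁-downward x⊑y y◁β , β∈P)

  safety⇒monitorable : Directed S → IsSafety → Monitorable
  safety⇒monitorable directed safe x with em {∃[ β ] (x ◁ β × β ∉ P)}
  ... | no ∄violation =
        x , IsPreorder.refl isPreorder ,
        ⊆⇒monitor≢Unknown (λ {β} x◁β →
          -- The absence of a violation yields only the double negation of `P β`.
          decidable-stable (P? β) (λ β∉P → ∄violation (β , x◁β , β∉P)))
  ... | yes (β , x◁β , β∉P) =
        let y , y◁β , y-No      = safe β β∉P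
            -- Directedness applies because `β` is compatible with both `x` and `y`.
            z , _ , x⊑z , y⊑z = directed x◁β y◁β
        in z , x⊑z , disjoint⇒monitor≢Unknown (disjoint-upward y⊑z (monitor≡No⇒disjoint y-No))

proposition4 : ∀ {b o r t p : Level} (em : ExcludedMiddle (b ⊔ t ⊔ p)) {𝔹 : Set b}
    (S : ObservationStructure 𝔹 o r t) → Directed S →
    (P : Pred 𝔹 p) →
    Monitoring.IsSafety em S P → Monitoring.Monitorable em S P
proposition4 em S directed P = safety⇒monitorable em S P directed
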